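{- Let $m,n\geq 1$, $\nu\geq 0$ and $0\leq s\leq n$ be integers, let $k_1=\cdots=k_s=\nu+1$ and $k_{s+1}=\cdots=k_n=\nu$, and let $\Sigma=\Sigma^{k_1,\ldots,k_n;\mathbf{1}}_{m,n}$ be the associated symmetric multiple chessboard complex. If $m\geq n(\nu+1)+s-1$, then $\Sigma$ is shellable.
   Context: Consider the chessboard $[m]\times[n]$ with $m$ columns and $n$ rows; its squares are the vertices. For nonnegative integers $a_1,\dots,a_n$, the multiple chessboard complex $\Delta^{a_1,\ldots,a_n;\mathbf{1}}_{m,n}$ is the simplicial complex of all rook placements $A\subseteq[m]\times[n]$ with at most one rook in each column and at most $a_i$ rooks in the $i$-th row. The symmetric multiple chessboard complex is $\Sigma^{k_1,\ldots,k_n;\mathbf{1}}_{m,n}=\bigcup_{\pi\in S_n}\Delta^{k_{\pi(1)},\ldots,k_{\pi(n)};\mathbf{1}}_{m,n}$ (the union of these subcomplexes of the full simplex on $[m]\times[n]$). -}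

module Defs where

open import Data.Nat using (ℕ; zero; suc; _+_; _≤_; _<_; _<?_)
open import Data.Bool using (Bool; true; false; if_then_else_; _∧_)
open import Data.Fin using (Fin; toℕ)
import Data.Fin as F
open import Data.Product using (_×_; Σ; ∃; ∃-syntax; _,_)
open import Data.Fin.Permutation using (Permutation′; _⟨$⟩ʳ_)
open import Relation.Binary.PropositionalEquality using (_≡_; _≢_)
open import Relation.Nullary.Decidable using (⌊_⌋)
open import Function.Bundles using (_⇔_)

-- Generic finite simplicial complexes on a vertex type V.
-- A (candidate) simplex is a subset of V, given by its characteristic
-- function. A simplicial complex is given by its predicate of faces.

SubsetOf : Set → Set
SubsetOf V = V → Bool

_⊆_ : {V : Set} → SubsetOf V → SubsetOf V → Set
A ⊆ B = ∀ v → A v ≡ true → B v ≡ true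

_∩_ : {V : Set} → SubsetOf V → SubsetOf V → SubsetOf V
(A ∩ B) v = A v ∧ B v

Complex : Set → Set₁
Complex V = SubsetOf V → Set

IsFacet : {V : Set} → Complex V → SubsetOf V → Set
IsFacet K F = K F × (∀ G → K G → F ⊆ G → G ⊆ F)

-- Shellability (Björner–Wachs, not necessarily pure): there is a linear
-- ordering F₀,…,F_{t-1} of all facets such that for all i < j there exist
-- k < j and a vertex v ∈ F_j with F_i ∩ F_j ⊆ F_k ∩ F_j = F_j ∖ {v}.
IsShellable : {V : Set} → Complex V → Set
IsShellable {V} K =
  ∃[ t ] Σ (Fin t → SubsetOf V) λ F →
      (∀ i → IsFacet K (F i))
    × (∀ G → IsFacet K G → ∃[ i ] (∀ v → G v ≡ F i v))
    × (∀ i j → toℕ i < toℕ j →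
         ∃[ k ] (toℕ k < toℕ j × Σ V λ v → F j v ≡ true ×
                   ((F i ∩ F j) ⊆ F k)
                 × (∀ w → ((F k ∩ F j) w ≡ true) ⇔ (F j w ≡ true × w ≢ v))))

-- Chessboard [m] × [n]: vertex (c , r) = square in column c, row r.

Board : ℕ → ℕ → Set
Board m n = Fin m × Fin n

count : ∀ {k} → (Fin k → Bool) → ℕ
count {zero} f = 0
count {suc k} f = (if f F.zero then 1 else 0) + count (λ i → f (F.suc i))

rowCount : ∀ {m n} → SubsetOf (Board m n) → Fin n → ℕ
rowCount A r = count (λ c → A (c , r))

colCount : ∀ {m n} → SubsetOf (Board m n) → Fin m → ℕ
colCount A c = count (λ r → A (c , r))

MultChessboard : (m n : ℕ) → (Fin n → ℕ) → Complex (Board m n)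
MultChessboard m n a A = (∀ c → colCount A c ≤ 1) × (∀ r → rowCount A r ≤ a r)

SymMultChessboard : (m n : ℕ) → (Fin n → ℕ) → Complex (Board m n)
SymMultChessboard m n k A =
  Σ (Permutation′ n) λ π → MultChessboard m n (λ i → k (π ⟨$⟩ʳ i)) A

kVec : (n ν s : ℕ) → Fin n → ℕ
kVec n ν s i = if ⌊ toℕ i <? s ⌋ then suc ν else ν

{-# OPTIONS --safe #-}

-- Facets are words of length m in the letters "blank" and "rook in row r": each row
-- occurs ν or ν + 1 times, and there are at least n − 1 blanks. They are shelled
-- lexicographically, column by column, where after j blanks the letters (rows 0, …, n − 1) are ordered
--   row min (j , n − 1)  <  blank  <  all other rows.
-- Let A precede B and first differ from it in column c, with j blanks before c.
--  * If B is blank at c, then A has the favoured row r there. Some rook of B lies outside A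
--    and may be moved to (c , r): one of row r if B has no fewer rooks there than A; otherwise
--    one of a row containing more rooks of B than of A, since then B has ν rooks in row r
--    and ν + 1 in that other row.
--  * If B has a rook at c, its row r is not the favoured one. Either r < j, and the rook moves
--    within its row to the earlier blank at which r was favoured, or j < r ≤ n − 1, so
--    that a blank remains to the right of c and the rook moves there.
module Submission where

open import Defs
open import Data.Bool using (Bool; true; false; if_then_else_; _∧_)
open import Data.Bool.Properties using (∧-conicalˡ; ∧-conicalʳ)
open import Data.Fin using (Fin; zero; suc; toℕ; fromℕ; fromℕ<; inject₁; punchIn)
import Data.Fin as F
open import Data.Fin.Permutation as Perm using (Permutation′; _⟨$⟩ʳ_; lift₀; insert; insert-punchIn)
open import Data.Fin.Properties as Fin using (any?; all?; toℕ-fromℕ; toℕ-fromℕ<; toℕ≤pred[n])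
open import Data.List as List using (List; []; _∷_; concatMap; filter; allFin)
open import Data.List.Membership.Propositional using (_∈_)
open import Data.List.Membership.Propositional.Properties using (∈-map⁺; ∈-concat⁺′; ∈-filter⁺; ∈-filter⁻; ∈-allFin; ∈-lookup)
open import Data.List.Relation.Unary.All as All using (All; []; _∷_)
import Data.List.Relation.Unary.All.Properties as All
open import Data.List.Relation.Unary.AllPairs as AllPairs using (AllPairs; []; _∷_)
import Data.List.Relation.Unary.AllPairs.Properties as AllPairs
open import Data.List.Relation.Unary.Any using (here; there; index)
open import Data.List.Relation.Unary.Any.Properties using (lookup-index)
open import Data.Maybe using (Maybe; just; nothing)
open import Data.Maybe.Properties using (just-injective; ≡-dec)
open import Data.Nat as ℕ using (ℕ; zero; suc; _+_; _*_; _∸_; _⊓_; _≤_; _<_; z≤n; s≤s; z<s; s<s; _≤?_; _<?_)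
open import Data.Nat.Properties hiding (_≟_)
open import Data.Product using (_×_; Σ; ∃; ∃-syntax; _,_; proj₁; proj₂)
open import Data.Sum using (_⊎_; inj₁; inj₂)
open import Data.Vec using (Vec; []; _∷_; lookup; tabulate; _[_]≔_)
open import Data.Vec.Properties using (lookup∘update; lookup∘update′; lookup∘tabulate)
open import Function using (_∘_)
open import Function.Bundles using (mk⇔; _⇔_)
open import Relation.Binary.Definitions using (tri<; tri≈; tri>)
open import Relation.Binary.PropositionalEquality
open import Relation.Nullary using (Dec; yes; no; does; ¬_; ¬?; contradiction)
open import Relation.Nullary.Decidable using (dec-true; dec-false; isYes≗does; _×-dec_)
open import Algebra.Properties.CommutativeSemigroup +-commutativeSemigroup using (interchange; xy∙z≈xz∙y)
open import Algebra.Properties.CommutativeMonoid.Sum +-0-commutativeMonoid using (sum; sum-cong-≗; ∑-distrib-+; sum-permute; sum-replicate-zero)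

private variable
  k m n : ℕ

-- Sums and counts over finite index sets

𝟙 : Bool → ℕ
𝟙 b = if b then 1 else 0

𝟙≤1 : ∀ b → 𝟙 b ≤ 1
𝟙≤1 true  = ≤-refl
𝟙≤1 false = z≤n

sum-mono-≤ : {f g : Fin k → ℕ} → (∀ i → f i ≤ g i) → sum f ≤ sum g
sum-mono-≤ {zero}  f≤g = z≤n
sum-mono-≤ {suc k} f≤g = +-mono-≤ (f≤g zero) (sum-mono-≤ (f≤g ∘ suc))

sum-mono-< : {f g : Fin k → ℕ} → (∀ i → f i ≤ g i) → ∀ i → f i < g i → sum f < sum g
sum-mono-< f≤g zero    f<g = +-mono-<-≤ f<g (sum-mono-≤ (f≤g ∘ suc))
sum-mono-< f≤g (suc i) f<g = +-mono-≤-< (f≤g zero) (sum-mono-< (f≤g ∘ suc) i f<g)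

sum-<⇒∃ : (f g : Fin k → ℕ) → sum f < sum g → ∃[ i ] f i < g i
sum-<⇒∃ f g Σf<Σg with any? (λ i → f i <? g i)
... | yes i,f<g = i,f<g
... | no ∄i     = contradiction (sum-mono-≤ (λ i → ≮⇒≥ (∄i ∘ (i ,_)))) (<⇒≱ Σf<Σg)

-- An excess of `f` at `i` has to be compensated at some other index. This is the exchange argument
-- that finds the rook to be moved when a blank is filled.
sum-≤⇒∃ : (f g : Fin k → ℕ) → sum f ≤ sum g → ∀ i → g i < f i → ∃[ j ] f j < g j
sum-≤⇒∃ f g Σf≤Σg i g<f with any? (λ j → f j <? g j)
... | yes j,f<g = j,f<g
... | no ∄j     = contradiction (sum-mono-< (λ j → ≮⇒≥ (∄j ∘ (j ,_))) i g<f) (≤⇒≯ Σf≤Σg)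

sum-≡⇒≗ : {f g : Fin k → ℕ} → (∀ i → f i ≤ g i) → sum f ≡ sum g → ∀ i → f i ≡ g i
sum-≡⇒≗ {f = f} {g} f≤g Σf≡Σg i with m≤n⇒m<n∨m≡n (f≤g i)
... | inj₂ f≡g = f≡g
... | inj₁ f<g = contradiction Σf≡Σg (<⇒≢ (sum-mono-< f≤g i f<g))

count≡sum : (f : Fin k → Bool) → count f ≡ sum (𝟙 ∘ f)
count≡sum {zero}  f = refl
count≡sum {suc k} f = cong (𝟙 (f zero) +_) (count≡sum (f ∘ suc))

count-cong : {f g : Fin k → Bool} → (∀ i → f i ≡ g i) → count f ≡ count g
count-cong {zero}  f≗g = refl
count-cong {suc k} f≗g = cong₂ _+_ (cong 𝟙 (f≗g zero)) (count-cong (f≗g ∘ suc))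

count-false : ∀ k → count {k} (λ _ → false) ≡ 0
count-false zero    = refl
count-false (suc k) = count-false k

count≡0⇒false : (f : Fin k → Bool) → count f ≡ 0 → ∀ i → f i ≡ false
count≡0⇒false {suc k} f f≡0 i with f zero in eq
count≡0⇒false {suc k} f f≡0 zero    | false = eq
count≡0⇒false {suc k} f f≡0 (suc i) | false = count≡0⇒false (f ∘ suc) f≡0 i

𝟙-< : ∀ {a b} → 𝟙 a < 𝟙 b → a ≡ false × b ≡ true
𝟙-< {false} {true}  _ = refl , refl
𝟙-< {true}  {true}  (s≤s ())

𝟙-mono : ∀ {a b} → (a ≡ true → b ≡ true) → 𝟙 a ≤ 𝟙 b
𝟙-mono {false}        a⇒b = z≤n
𝟙-mono {true}  {b}    a⇒b rewrite a⇒b refl = ≤-refl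

count-<⇒∃ : (f g : Fin k → Bool) → count f < count g → ∃[ i ] f i ≡ false × g i ≡ true
count-<⇒∃ f g f<g with sum-<⇒∃ (𝟙 ∘ f) (𝟙 ∘ g) (subst₂ _<_ (count≡sum f) (count≡sum g) f<g)
... | i , fi<gi = i , 𝟙-< fi<gi

count-≤⇒∃ : (f g : Fin k → Bool) → count f ≤ count g →
  ∀ i → f i ≡ true → g i ≡ false → ∃[ j ] f j ≡ false × g j ≡ true
count-≤⇒∃ f g f≤g i fi gi
  with sum-≤⇒∃ (𝟙 ∘ f) (𝟙 ∘ g) (subst₂ _≤_ (count≡sum f) (count≡sum g) f≤g) i
         (subst₂ (λ a b → 𝟙 a < 𝟙 b) (sym gi) (sym fi) ≤-refl)
... | j , fj<gj = j , 𝟙-< fj<gj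

count-mono-≤ : {f g : Fin k → Bool} → (∀ i → f i ≡ true → g i ≡ true) → count f ≤ count g
count-mono-≤ {f = f} {g} f⇒g =
  subst₂ _≤_ (sym (count≡sum f)) (sym (count≡sum g)) (sum-mono-≤ (𝟙-mono ∘ f⇒g))

count-mono-< : {f g : Fin k → Bool} → (∀ i → f i ≡ true → g i ≡ true) →
  ∀ i → f i ≡ false → g i ≡ true → count f < count g
count-mono-< {f = f} {g} f⇒g i fi gi = subst₂ _<_ (sym (count≡sum f)) (sym (count≡sum g))
  (sum-mono-< (𝟙-mono ∘ f⇒g) i (subst₂ (λ a b → 𝟙 a < 𝟙 b) (sym fi) (sym gi) ≤-refl))

-- Permutations that bring chosen indices to the front

punchIn-fromℕ : ∀ n (i : Fin n) → punchIn (fromℕ n) i ≡ inject₁ i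
punchIn-fromℕ (suc n) zero    = refl
punchIn-fromℕ (suc n) (suc i) = cong suc (punchIn-fromℕ n i)

-- Induction on `n`: a true first entry goes to the front and shifts the other images up by one; a
-- false one goes to the last place, which leaves the other images as they are. Applied to the rows
-- with `ν + 1` rooks, it supplies the permutation that a face of the symmetric complex asks for.
sortingPermutation : (f : Fin n → Bool) →
  Σ (Permutation′ n) λ π → ∀ i → f i ≡ does (toℕ (π ⟨$⟩ʳ i) <? count f)
sortingPermutation {zero}  f = Perm.id , λ ()
sortingPermutation {suc n} f with f zero in eq | sortingPermutation (f ∘ suc)
... | true  | π , sorts = lift₀ π , λ { zero → eq ; (suc i) → sorts i }
... | false | π , sorts = insert zero (fromℕ n) π , λ
  { zero    → trans eq (sym (dec-false (_ <? _) (≤⇒≯ (subst (count (f ∘ suc) ≤_) (sym (toℕ-fromℕ n)) (count≤ (f ∘ suc))))))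
  ; (suc i) → trans (sorts i) (cong (λ r → does (r <? count (f ∘ suc))) (sym (toℕ-insert i)))
  }
  where
  count≤ : ∀ {k} (f : Fin k → Bool) → count f ≤ k
  count≤ {zero}  f = z≤n
  count≤ {suc k} f = +-mono-≤ (𝟙≤1 (f zero)) (count≤ (f ∘ suc))
  toℕ-insert : ∀ i → toℕ (insert zero (fromℕ n) π ⟨$⟩ʳ suc i) ≡ toℕ (π ⟨$⟩ʳ i)
  toℕ-insert i = trans
    (cong toℕ (trans (insert-punchIn zero (fromℕ n) π i) (punchIn-fromℕ n _)))
    (Fin.toℕ-inject₁ _)

-- Rook placements as words

Letter : ℕ → Set
Letter n = Maybe (Fin n)

_≟_ : (a b : Letter n) → Dec (a ≡ b)
_≟_ = ≡-dec F._≟_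

_==_ : Letter n → Letter n → Bool
a == b = does (a ≟ b)

==⇒≡ : (a b : Letter n) → (a == b) ≡ true → a ≡ b
==⇒≡ a b eq with a ≟ b
... | yes a≡b = a≡b

==⇒≢ : (a b : Letter n) → (a == b) ≡ false → a ≢ b
==⇒≢ a b eq with a ≟ b
... | no a≢b = a≢b

≡⇒== : {a b : Letter n} → a ≡ b → (a == b) ≡ true
≡⇒== {a = a} {b} = dec-true (a ≟ b)

≢⇒== : {a b : Letter n} → a ≢ b → (a == b) ≡ false
≢⇒== {a = a} {b} = dec-false (a ≟ b)

-- The letter of a column is the row of its rook, or `nothing` for a blank column. The bound of one
-- rook per column is thus built into the type.
Word : ℕ → ℕ → Set
Word m n = Vec (Letter n) m

toSubset : Word m n → SubsetOf (Board m n)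
toSubset w (c , r) = lookup w c == just r

occ : Letter n → Word m n → ℕ
occ l w = count (λ c → lookup w c == l)

count-rows : (l : Letter n) → count (λ r → l == just r) + 𝟙 (l == nothing) ≡ 1
count-rows {zero}  nothing        = refl
count-rows {suc n} nothing        = cong (_+ 1) (count-false n)
count-rows {suc n} (just zero)    = cong (λ t → suc t + 0) (count-false n)
count-rows {suc n} (just (suc i)) = count-rows (just i)

sum-occ : (w : Word m n) → sum (λ r → occ (just r) w) + occ nothing w ≡ m
sum-occ {n = n} [] = trans (+-identityʳ _) (sum-replicate-zero n)
sum-occ {suc m} (l ∷ w) = begin
  sum (λ r → 𝟙 (l == just r) + occ (just r) w) + (𝟙 (l == nothing) + occ nothing w)
    ≡⟨ cong (_+ (𝟙 (l == nothing) + occ nothing w)) (∑-distrib-+ (λ r → 𝟙 (l == just r)) (λ r → occ (just r) w)) ⟩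
  sum (λ r → 𝟙 (l == just r)) + sum (λ r → occ (just r) w) + (𝟙 (l == nothing) + occ nothing w)
    ≡⟨ interchange (sum (λ r → 𝟙 (l == just r))) _ _ _ ⟩
  (sum (λ r → 𝟙 (l == just r)) + 𝟙 (l == nothing)) + (sum (λ r → occ (just r) w) + occ nothing w)
    ≡⟨ cong₂ _+_ (trans (cong (_+ 𝟙 (l == nothing)) (sym (count≡sum (λ r → l == just r)))) (count-rows l)) (sum-occ w) ⟩
  suc m ∎
  where open ≡-Reasoning

-- The overwritten letter is added on the left rather than subtracted on the right, so that no
-- truncated subtraction occurs.
occ-update : (w : Word m n) (c : Fin m) (a l : Letter n) →
  occ l (w [ c ]≔ a) + 𝟙 (lookup w c == l) ≡ occ l w + 𝟙 (a == l)
occ-update (b ∷ w) zero a l = begin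
  𝟙 (a == l) + occ l w + 𝟙 (b == l)   ≡⟨ +-comm (𝟙 (a == l) + occ l w) _ ⟩
  𝟙 (b == l) + (𝟙 (a == l) + occ l w) ≡⟨ cong (𝟙 (b == l) +_) (+-comm (𝟙 (a == l)) _) ⟩
  𝟙 (b == l) + (occ l w + 𝟙 (a == l)) ≡⟨ +-assoc (𝟙 (b == l)) _ _ ⟨
  𝟙 (b == l) + occ l w + 𝟙 (a == l)   ∎
  where open ≡-Reasoning
occ-update (b ∷ w) (suc c) a l = begin
  𝟙 (b == l) + occ l (w [ c ]≔ a) + 𝟙 (lookup w c == l)   ≡⟨ +-assoc (𝟙 (b == l)) _ _ ⟩
  𝟙 (b == l) + (occ l (w [ c ]≔ a) + 𝟙 (lookup w c == l)) ≡⟨ cong (𝟙 (b == l) +_) (occ-update w c a l) ⟩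
  𝟙 (b == l) + (occ l w + 𝟙 (a == l))                     ≡⟨ +-assoc (𝟙 (b == l)) _ _ ⟨
  𝟙 (b == l) + occ l w + 𝟙 (a == l)                       ∎
  where open ≡-Reasoning

decodeColumn : (f : Fin n → Bool) → count f ≤ 1 → ∃[ l ] ∀ r → f r ≡ (l == just r)
decodeColumn {zero}  f f≤1 = nothing , λ ()
decodeColumn {suc n} f f≤1 with f zero in eq
... | true  = just zero , λ
  { zero    → eq
  ; (suc r) → count≡0⇒false (f ∘ suc) (n≤0⇒n≡0 (≤-pred f≤1)) r }
... | false with decodeColumn (f ∘ suc) f≤1
...   | nothing , dec = nothing , λ { zero → eq ; (suc r) → dec r }
...   | just i  , dec = just (suc i) , λ { zero → eq ; (suc r) → dec r }

decode : (G : SubsetOf (Board m n)) → (∀ c → colCount G c ≤ 1) →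
  ∃[ w ] ∀ v → G v ≡ toSubset w v
decode G cols = tabulate column , λ (c , r) →
  trans (proj₂ (decodeColumn _ (cols c)) r)
        (cong (_== just r) (sym (lookup∘tabulate column c)))
  where
  column : ∀ c → Letter _
  column c = proj₁ (decodeColumn (λ r → G (c , r)) (cols c))

-- Row capacities and balanced words

kVec≡ : ∀ ν s (i : Fin n) → kVec n ν s i ≡ ν + 𝟙 (does (toℕ i <? s))
kVec≡ ν s i rewrite isYes≗does (toℕ i <? s) with does (toℕ i <? s)
... | true  = +-comm 1 ν
... | false = sym (+-identityʳ ν)

sum-ν+ : ∀ ν (f : Fin n → ℕ) → sum (λ i → ν + f i) ≡ n * ν + sum f
sum-ν+ {n} ν f = trans (∑-distrib-+ (λ _ → ν) f) (cong (_+ sum f) (sum-const n))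
  where
  sum-const : ∀ n → sum {n} (λ _ → ν) ≡ n * ν
  sum-const zero    = refl
  sum-const (suc n) = cong (ν +_) (sum-const n)

sum-𝟙<s : ∀ {s} → s ≤ n → sum {n} (λ i → 𝟙 (does (toℕ i <? s))) ≡ s
sum-𝟙<s {n}          z≤n       = sum-replicate-zero n
sum-𝟙<s {suc n} {suc s} (s≤s s≤n) = cong suc (sum-𝟙<s s≤n)

sum-kVec : ∀ ν {s} → s ≤ n → sum (kVec n ν s) ≡ n * ν + s
sum-kVec {n} ν {s} s≤n = begin
  sum (kVec n ν s)                             ≡⟨ sum-cong-≗ {n} (kVec≡ ν s) ⟩
  sum {n} (λ i → ν + 𝟙 (does (toℕ i <? s)))    ≡⟨ sum-ν+ ν (λ (i : Fin n) → 𝟙 (does (toℕ i <? s))) ⟩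
  n * ν + sum {n} (λ i → 𝟙 (does (toℕ i <? s))) ≡⟨ cong (n * ν +_) (sum-𝟙<s s≤n) ⟩
  n * ν + s                                    ∎
  where open ≡-Reasoning

-- The condition on blanks says that there are n ν + s rooks in total.
Balanced : (m n ν s : ℕ) → Word m n → Set
Balanced m n ν s w =
  occ nothing w + (n * ν + s) ≡ m × (∀ r → ν ≤ occ (just r) w × occ (just r) w ≤ suc ν)

balanced? : ∀ m n ν s (w : Word m n) → Dec (Balanced m n ν s w)
balanced? m n ν s w =
  (occ nothing w + (n * ν + s) ℕ.≟ m) ×-dec
  all? (λ r → (ν ≤? occ (just r) w) ×-dec (occ (just r) w ≤? suc ν))

colCount≤1 : (w : Word m n) → ∀ c → colCount (toSubset w) c ≤ 1
colCount≤1 w c = m+n≤o⇒m≤o _ (≤-reflexive (count-rows (lookup w c)))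

toSubset-true : (w : Word m n) {c : Fin m} {r : Fin n} → toSubset w (c , r) ≡ true → lookup w c ≡ just r
toSubset-true w = ==⇒≡ _ _

-- The facets are exactly the balanced words

module _ {m n ν s : ℕ} where

  sum-balanced : {w : Word m n} → Balanced m n ν s w → sum (λ r → occ (just r) w) ≡ n * ν + s
  sum-balanced {w} (blanks , _) = +-cancelʳ-≡ (occ nothing w) _ _
    (trans (sum-occ w) (trans (sym blanks) (+-comm (occ nothing w) _)))

  -- Row counts `ν` or `ν + 1` with total `n * ν + s` leave exactly `s` rows with `ν + 1` rooks.
  -- Sorting these to the front matches them with the first `s` entries of `kVec`.
  balanced⇒face : {w : Word m n} → Balanced m n ν s w → SymMultChessboard m n (kVec n ν s) (toSubset w)
  balanced⇒face {w} bal@(_ , bounds) =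
    π , colCount≤1 w , λ r → ≤-reflexive (trans (occ≡ r) (sym (kVec∘π r)))
    where
    full : Fin n → Bool
    full r = does (occ (just r) w ℕ.≟ suc ν)
    occ≡ : ∀ r → occ (just r) w ≡ ν + 𝟙 (full r)
    occ≡ r with m≤n⇒m<n∨m≡n (proj₂ (bounds r))
    ... | inj₁ occ<1+ν = trans (≤-antisym (≤-pred occ<1+ν) (proj₁ (bounds r)))
      (sym (trans (cong (λ b → ν + 𝟙 b) (dec-false (_ ℕ.≟ _) (<⇒≢ occ<1+ν))) (+-identityʳ ν)))
    ... | inj₂ occ≡1+ν = trans occ≡1+ν
      (sym (trans (cong (λ b → ν + 𝟙 b) (dec-true (_ ℕ.≟ _) occ≡1+ν)) (+-comm ν 1)))
    count-full : count full ≡ s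
    count-full = trans (count≡sum full) (+-cancelˡ-≡ (n * ν) _ _
      (trans (sym (trans (sum-cong-≗ occ≡) (sum-ν+ ν (𝟙 ∘ full)))) (sum-balanced {w} bal)))
    π : Permutation′ n
    π = proj₁ (sortingPermutation full)
    kVec∘π : ∀ r → kVec n ν s (π ⟨$⟩ʳ r) ≡ ν + 𝟙 (full r)
    kVec∘π r = begin
      kVec n ν s (π ⟨$⟩ʳ r)                           ≡⟨ kVec≡ ν s (π ⟨$⟩ʳ r) ⟩
      ν + 𝟙 (does (toℕ (π ⟨$⟩ʳ r) <? s))              ≡⟨ cong (λ t → ν + 𝟙 (does (toℕ (π ⟨$⟩ʳ r) <? t))) count-full ⟨
      ν + 𝟙 (does (toℕ (π ⟨$⟩ʳ r) <? count full))     ≡⟨ cong (λ b → ν + 𝟙 b) (proj₂ (sortingPermutation full) r) ⟨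
      ν + 𝟙 (full r)                                  ∎
      where open ≡-Reasoning

  module _ (s≤n : s ≤ n) where

    sum-kVec∘π : (π : Permutation′ n) → sum (λ r → kVec n ν s (π ⟨$⟩ʳ r)) ≡ n * ν + s
    sum-kVec∘π π = trans (sym (sum-permute (kVec n ν s) π)) (sum-kVec ν s≤n)

    -- A permutation does not change the sum of the capacities, so no face has more than `n * ν + s`
    -- rooks. A balanced word attains this bound and cannot be enlarged.
    balanced⇒facet : {w : Word m n} → Balanced m n ν s w →
      IsFacet (SymMultChessboard m n (kVec n ν s)) (toSubset w)
    balanced⇒facet {w} bal = balanced⇒face {w} bal , maximal
      where
      maximal : ∀ G → SymMultChessboard m n (kVec n ν s) G → toSubset w ⊆ G → G ⊆ toSubset w
      maximal G (π , _ , rows) w⊆G (c , r) cr∈G with toSubset w (c , r) in eq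
      ... | true  = refl
      ... | false = contradiction Σw<Σw (<-irrefl refl)
        where
        Σw<Σw : n * ν + s < n * ν + s
        Σw<Σw = begin-strict
          n * ν + s                            ≡⟨ sum-balanced {w} bal ⟨
          sum (rowCount (toSubset w))          <⟨ sum-mono-< (λ r → count-mono-≤ (λ c → w⊆G (c , r))) r
                                                    (count-mono-< (λ c → w⊆G (c , r)) c eq cr∈G) ⟩
          sum (rowCount G)                     ≤⟨ sum-mono-≤ rows ⟩
          sum (λ r → kVec n ν s (π ⟨$⟩ʳ r))    ≡⟨ sum-kVec∘π π ⟩
          n * ν + s                            ∎
          where open ≤-Reasoning

    -- With fewer than `n * ν + s` rooks, some row is below its capacity and, since `n * ν + s ≤ m`,
    -- some column is blank; a rook where they cross would enlarge the face. Hence every row attains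
    -- its capacity, which is `ν` or `ν + 1`.
    facet⇒balanced : n * ν + s ≤ m → ∀ G → IsFacet (SymMultChessboard m n (kVec n ν s)) G →
      ∃[ w ] Balanced m n ν s w × (∀ v → G v ≡ toSubset w v)
    facet⇒balanced N≤m G ((π , cols , rows) , maximal) with decode G cols
    ... | w , G≗w = w , bal (m≤n⇒m<n∨m≡n Σocc≤N) , G≗w
      where
      rows′ : ∀ r → occ (just r) w ≤ kVec n ν s (π ⟨$⟩ʳ r)
      rows′ r = subst (_≤ kVec n ν s (π ⟨$⟩ʳ r)) (count-cong (λ c → G≗w (c , r))) (rows r)
      Σocc≤N : sum (λ r → occ (just r) w) ≤ n * ν + s
      Σocc≤N = subst (sum (λ r → occ (just r) w) ≤_) (sum-kVec∘π π) (sum-mono-≤ rows′)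
      bal : sum (λ r → occ (just r) w) < n * ν + s ⊎ sum (λ r → occ (just r) w) ≡ n * ν + s →
        Balanced m n ν s w
      bal (inj₂ Σocc≡N) =
        trans (+-comm (occ nothing w) _) (trans (cong (_+ occ nothing w) (sym Σocc≡N)) (sum-occ w)) ,
        λ r → subst (λ t → ν ≤ t × t ≤ suc ν) (sym (occ≡ r))
          (m≤m+n ν _ , ≤-trans (+-monoʳ-≤ ν (𝟙≤1 _)) (≤-reflexive (+-comm ν 1)))
        where
        occ≡ : ∀ r → occ (just r) w ≡ ν + 𝟙 (does (toℕ (π ⟨$⟩ʳ r) <? s))
        occ≡ r = trans (sum-≡⇒≗ rows′ (trans Σocc≡N (sym (sum-kVec∘π π))) r) (kVec≡ ν s (π ⟨$⟩ʳ r))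
      bal (inj₁ Σocc<N)
        with sum-<⇒∃ (λ r → occ (just r) w) (λ r → kVec n ν s (π ⟨$⟩ʳ r))
               (subst (sum (λ r → occ (just r) w) <_) (sym (sum-kVec∘π π)) Σocc<N)
           | count-<⇒∃ (λ _ → false) (λ c → lookup w c == nothing)
               (subst (_< occ nothing w) (sym (count-false m)) 0<blanks)
        where
        0<blanks : 0 < occ nothing w
        0<blanks = +-cancelˡ-< (sum (λ r → occ (just r) w)) 0 _
          (subst₂ _<_ (sym (+-identityʳ _)) (sym (sum-occ w)) (<-≤-trans Σocc<N N≤m))
      ... | r , roomy | c , _ , blank = contradiction (trans (sym w≢cr) (trans (sym (G≗w (c , r))) cr∈G)) λ ()
        where
        w[c]≡nothing : lookup w c ≡ nothing
        w[c]≡nothing = ==⇒≡ _ _ blank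
        w≢cr : toSubset w (c , r) ≡ false
        w≢cr = cong (_== just r) w[c]≡nothing
        w⁺ : Word m n
        w⁺ = w [ c ]≔ just r
        rows⁺ : ∀ x → occ (just x) w⁺ ≤ kVec n ν s (π ⟨$⟩ʳ x)
        rows⁺ x with occ-update w c (just r) (just x)
        -- Column `c` was blank, so no row loses a rook, and only row `r` gains one.
        ... | occ-eq rewrite w[c]≡nothing | +-identityʳ (occ (just x) w⁺) | occ-eq with r F.≟ x
        ...   | yes refl = subst (_≤ kVec n ν s (π ⟨$⟩ʳ r)) (+-comm 1 _) roomy
        ...   | no _     = subst (_≤ kVec n ν s (π ⟨$⟩ʳ x)) (sym (+-identityʳ _)) (rows′ x)
        G⊆w⁺ : G ⊆ toSubset w⁺
        G⊆w⁺ (x , y) xy∈G = ≡⇒== (trans (lookup∘update′ x≢c w (just r)) w[x]≡y)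
          where
          w[x]≡y : lookup w x ≡ just y
          w[x]≡y = toSubset-true w (trans (sym (G≗w (x , y))) xy∈G)
          x≢c : x ≢ c
          x≢c refl = contradiction (trans (sym w[x]≡y) w[c]≡nothing) λ ()
        cr∈G : G (c , r) ≡ true
        cr∈G = maximal (toSubset w⁺) (π , colCount≤1 w⁺ , rows⁺) G⊆w⁺ (c , r)
          (≡⇒== (lookup∘update c w (just r)))

-- The order on letters and the lexicographic order on words

favoured : ℕ → Fin (suc n)
-- The board has `suc n` rows here. The last one, `n`, stays favoured however many further blanks
-- occur.
favoured {n} j = fromℕ< (s≤s (m⊓n≤n j n))

-- Comparing letters through numbers reduces the changing orders of the columns to `_<_`. The offset
-- `2` leaves room for the favoured row and the blank.
rank : ℕ → Letter (suc n) → ℕ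
rank j nothing  = 1
rank j (just r) = if does (r F.≟ favoured j) then 0 else 2 + toℕ r

rank-favoured : ∀ {j} {r : Fin (suc n)} → r ≡ favoured j → rank j (just r) ≡ 0
rank-favoured {j = j} {r} eq = cong (λ b → if b then 0 else 2 + toℕ r) (dec-true (r F.≟ favoured j) eq)

rank-other : ∀ {j} {r : Fin (suc n)} → r ≢ favoured j → rank j (just r) ≡ 2 + toℕ r
rank-other {j = j} {r} neq = cong (λ b → if b then 0 else 2 + toℕ r) (dec-false (r F.≟ favoured j) neq)

rank<1⇒favoured : ∀ j (l : Letter (suc n)) → rank j l < 1 → l ≡ just (favoured j)
rank<1⇒favoured j nothing  (s≤s ())
rank<1⇒favoured j (just r) lt with r F.≟ favoured j
rank<1⇒favoured j (just r) lt       | yes refl = refl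
rank<1⇒favoured j (just r) (s≤s ()) | no _

letters : ∀ n → ℕ → List (Letter (suc n))
letters n j = just (favoured j) ∷ nothing ∷ List.map just (filter (λ r → ¬? (r F.≟ favoured j)) (allFin (suc n)))

letters-sorted : ∀ n j → AllPairs (λ a b → rank j a < rank j b) (letters n j)
letters-sorted n j =
  (favoured<blank ∷ All.map⁺ (All.map (<-trans favoured<blank ∘ blank<other) others)) ∷
  All.map⁺ (All.map blank<other others) ∷
  AllPairs.map⁺ (others-sorted (AllPairs.tabulate⁺-< (λ i<j → i<j)))
  where
  other? : (r : Fin (suc n)) → Dec (r ≢ favoured j)
  other? r = ¬? (r F.≟ favoured j)
  others : All (_≢ favoured j) (filter other? (allFin (suc n)))
  others = All.all-filter other? (allFin (suc n))
  favoured<blank : rank j (just (favoured {n} j)) < 1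
  favoured<blank = subst (_< 1) (sym (rank-favoured {j = j} refl)) z<s
  blank<other : ∀ {r : Fin (suc n)} → r ≢ favoured j → 1 < rank j (just r)
  blank<other neq = subst (1 <_) (sym (rank-other neq)) (s<s z<s)
  others-sorted : ∀ {rs} → AllPairs F._<_ rs →
    AllPairs (λ a b → rank j (just a) < rank j (just b)) (filter other? rs)
  others-sorted []                 = []
  others-sorted {r ∷ rs} (r<rs ∷ rs!) with r F.≟ favoured j
  ... | yes _  = others-sorted rs!
  ... | no neq = All.zipWith (λ { (r<x , x≢) → subst₂ _<_ (sym (rank-other neq)) (sym (rank-other x≢)) (s<s (s<s r<x)) })
                   (All.filter⁺ other? r<rs , All.all-filter other? rs) ∷ others-sorted rs!

∈-letters : ∀ j (l : Letter (suc n)) → l ∈ letters n j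
∈-letters j nothing = there (here refl)
∈-letters j (just r) with r F.≟ favoured j
... | yes refl = here refl
... | no neq   = there (there (∈-map⁺ just (∈-filter⁺ (λ r → ¬? (r F.≟ favoured j)) (∈-allFin r) neq)))

step : Letter n → ℕ → ℕ
step nothing  j = suc j
step (just _) j = j

blanksBefore : ℕ → Word m n → Fin m → ℕ
blanksBefore j (l ∷ w) zero    = j
blanksBefore j (l ∷ w) (suc c) = blanksBefore (step l j) w c

infix 4 _⊢_≺_
-- A lexicographic order in which the order on the letters of a column depends on the common prefix,
-- through the number of blanks in it.
data _⊢_≺_ : ℕ → Word m (suc n) → Word m (suc n) → Set where
  here  : ∀ {j a b} {u v : Word m (suc n)} → rank j a < rank j b → j ⊢ a ∷ u ≺ b ∷ v
  there : ∀ {j a} {u v : Word m (suc n)} → step a j ⊢ u ≺ v → j ⊢ a ∷ u ≺ a ∷ v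

≺-asym : ∀ {j} {u v : Word m (suc n)} → j ⊢ u ≺ v → ¬ (j ⊢ v ≺ u)
≺-asym (here a<b)  (here b<a)  = <-asym a<b b<a
≺-asym (here a<a)  (there _)   = <-irrefl refl a<a
≺-asym (there _)   (here a<a)  = <-irrefl refl a<a
≺-asym (there u≺v) (there v≺u) = ≺-asym u≺v v≺u

-- Blanks are counted in `v`, but `u` would give the same number, as both words agree before `c`.
FirstDifference : ℕ → (u v : Word m (suc n)) → Fin m → Set
FirstDifference j u v c =
  (∀ q → q F.< c → lookup u q ≡ lookup v q) ×
  rank (blanksBefore j v c) (lookup u c) < rank (blanksBefore j v c) (lookup v c)

≺⇒firstDifference : ∀ {j} {u v : Word m (suc n)} → j ⊢ u ≺ v → ∃ (FirstDifference j u v)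
≺⇒firstDifference (here a<b) = zero , (λ _ ()) , a<b
≺⇒firstDifference (there u≺v) with ≺⇒firstDifference u≺v
... | c , agree , lt = suc c , (λ { zero _ → refl ; (suc q) (s≤s q<c) → agree q q<c }) , lt

firstDifference⇒≺ : ∀ {j} {u v : Word m (suc n)} c → FirstDifference j u v c → j ⊢ u ≺ v
firstDifference⇒≺ {u = _ ∷ _} {_ ∷ _} zero    (_ , lt)     = here lt
firstDifference⇒≺ {u = _ ∷ _} {_ ∷ _} (suc c) (agree , lt) with refl ← agree zero z<s =
  there (firstDifference⇒≺ c ((λ q q<c → agree (suc q) (s<s q<c)) , lt))

-- Listing all words in increasing order

words : ∀ m n → ℕ → List (Word m (suc n))
words zero    n j = [] ∷ []
words (suc m) n j = concatMap (λ l → List.map (l ∷_) (words m n (step l j))) (letters n j)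

-- Words with the same first letter form a block, sorted by induction; words of different blocks are
-- compared by their first letters.
words-sorted : ∀ m n j → AllPairs (j ⊢_≺_) (words m n j)
words-sorted zero    n j = [] ∷ []
words-sorted (suc m) n j = AllPairs.concat⁺
  (All.map⁺ (All.universal (λ l → AllPairs.map⁺ (AllPairs.map there (words-sorted m n (step l j)))) (letters n j)))
  (AllPairs.map⁺ (AllPairs.map
    (λ a<b → All.map⁺ (All.universal (λ _ → All.map⁺ (All.universal (λ _ → here a<b) _)) _))
    (letters-sorted n j)))

∈-words : ∀ j (w : Word m (suc n)) → w ∈ words m n j
∈-words j []      = here refl
∈-words j (l ∷ w) = ∈-concat⁺′ (∈-map⁺ (l ∷_) (∈-words (step l j) w)) (∈-map⁺ (λ l → List.map (l ∷_) (words _ _ (step l j))) (∈-letters j l))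

lookup-sorted : {A : Set} {R : A → A → Set} {xs : List A} → AllPairs R xs →
  ∀ {i j} → i F.< j → R (List.lookup xs i) (List.lookup xs j)
lookup-sorted {xs = x ∷ xs} (Rx ∷ _)  {zero}  {suc j} _         = All.lookup Rx (∈-lookup {xs = xs} j)
lookup-sorted {xs = x ∷ xs} (_ ∷ Rxs) {suc i} {suc j} (s≤s i<j) = lookup-sorted Rxs i<j

-- Equal or reversed positions would contradict asymmetry. This turns `≺` between two facets into
-- the order of their positions in the shelling.
index-< : {A : Set} {R : A → A → Set} → (∀ {x y} → R x y → ¬ R y x) →
  {xs : List A} → AllPairs R xs → ∀ i j → R (List.lookup xs i) (List.lookup xs j) → i F.< j
index-< asym sorted i j Rij with Fin.<-cmp i j
... | tri< i<j _ _  = i<j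
... | tri≈ _ refl _ = contradiction Rij (asym Rij)
... | tri> _ _ j<i  = contradiction (lookup-sorted sorted j<i) (asym Rij)

-- Not all blanks occur before `c`, and `c` itself is not blank. For the induction, `j` counts the
-- blanks already passed.
later-blank : ∀ j (w : Word m n) c → blanksBefore j w c < j + occ nothing w → lookup w c ≢ nothing →
  ∃[ q ] c F.< q × lookup w q ≡ nothing
later-blank {suc m} j (l ∷ w) zero j<j+b l≢nothing
  with count-<⇒∃ (λ _ → false) (λ c → lookup w c == nothing)
         (subst₂ _<_ (sym (count-false m)) (cong (λ b → 𝟙 b + occ nothing w) (≢⇒== l≢nothing))
           (+-cancelˡ-< j 0 _ (subst (_< j + occ nothing (l ∷ w)) (sym (+-identityʳ j)) j<j+b)))
... | q , _ , blank = suc q , z<s , ==⇒≡ _ _ blank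
later-blank j (nothing ∷ w) (suc c) lt w[c]≢nothing
  with later-blank (suc j) w c (subst (blanksBefore (suc j) w c <_) (+-suc j _) lt) w[c]≢nothing
... | q , c<q , blank = suc q , s<s c<q , blank
later-blank j (just _ ∷ w) (suc c) lt w[c]≢nothing with later-blank j w c lt w[c]≢nothing
... | q , c<q , blank = suc q , s<s c<q , blank

-- The count grows from `j` in steps of one, so it takes the value `i` on its way, and it leaves
-- that value only at a blank.
earlier-blank : ∀ j (w : Word m n) c i → j ≤ i → i < blanksBefore j w c →
  ∃[ q ] q F.< c × lookup w q ≡ nothing × blanksBefore j w q ≡ i
earlier-blank j (l ∷ w) zero i j≤i i<j = contradiction i<j (≤⇒≯ j≤i)
earlier-blank j (nothing ∷ w) (suc c) i j≤i i<b with m≤n⇒m<n∨m≡n j≤i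
... | inj₂ j≡i = zero , z<s , refl , j≡i
... | inj₁ j<i with earlier-blank (suc j) w c i j<i i<b
...   | q , q<c , blank , eq = suc q , s<s q<c , blank , eq
earlier-blank j (just _ ∷ w) (suc c) i j≤i i<b with earlier-blank j w c i j≤i i<b
... | q , q<c , blank , eq = suc q , s<s q<c , blank , eq

-- Moving one rook

relocate : Word m n → Fin m → Fin m → Fin n → Word m n
relocate w p q r = w [ p ]≔ nothing [ q ]≔ just r

module _ (w : Word m n) {p q : Fin m} {r₀ r : Fin n}
  (w[p] : lookup w p ≡ just r₀) (w[q] : lookup w q ≡ nothing) where

  q≢p : q ≢ p
  q≢p refl = contradiction (trans (sym w[q]) w[p]) λ ()

  lookup-relocate-p : lookup (relocate w p q r) p ≡ nothing
  lookup-relocate-p = trans (lookup∘update′ (q≢p ∘ sym) (w [ p ]≔ nothing) (just r)) (lookup∘update p w nothing)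

  lookup-relocate-q : lookup (relocate w p q r) q ≡ just r
  lookup-relocate-q = lookup∘update q (w [ p ]≔ nothing) (just r)

  lookup-relocate : ∀ {x} → x ≢ p → x ≢ q → lookup (relocate w p q r) x ≡ lookup w x
  lookup-relocate x≢p x≢q = trans (lookup∘update′ x≢q (w [ p ]≔ nothing) (just r)) (lookup∘update′ x≢p w nothing)

  -- Column `p` becomes blank and `q` ceases to be, so in the two updates the contributions of the
  -- blank cancel.
  occ-relocate : ∀ l → occ l (relocate w p q r) + 𝟙 (just r₀ == l) ≡ occ l w + 𝟙 (just r == l)
  occ-relocate l = +-cancelʳ-≡ (𝟙 (nothing == l)) _ _ (begin
    occ l w″ + 𝟙 (just r₀ == l) + 𝟙 (nothing == l)        ≡⟨ xy∙z≈xz∙y (occ l w″) _ _ ⟩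
    occ l w″ + 𝟙 (nothing == l) + 𝟙 (just r₀ == l)        ≡⟨ cong (λ a → occ l w″ + 𝟙 (a == l) + 𝟙 (just r₀ == l)) w′[q] ⟨
    occ l w″ + 𝟙 (lookup w′ q == l) + 𝟙 (just r₀ == l)    ≡⟨ cong (_+ 𝟙 (just r₀ == l)) (occ-update w′ q (just r) l) ⟩
    occ l w′ + 𝟙 (just r == l) + 𝟙 (just r₀ == l)         ≡⟨ xy∙z≈xz∙y (occ l w′) _ _ ⟩
    occ l w′ + 𝟙 (just r₀ == l) + 𝟙 (just r == l)         ≡⟨ cong (λ a → occ l w′ + 𝟙 (a == l) + 𝟙 (just r == l)) w[p] ⟨
    occ l w′ + 𝟙 (lookup w p == l) + 𝟙 (just r == l)      ≡⟨ cong (_+ 𝟙 (just r == l)) (occ-update w p nothing l) ⟩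
    occ l w + 𝟙 (nothing == l) + 𝟙 (just r == l)          ≡⟨ xy∙z≈xz∙y (occ l w) _ _ ⟩
    occ l w + 𝟙 (just r == l) + 𝟙 (nothing == l)          ∎)
    where
    open ≡-Reasoning
    w′ w″ : Word m n
    w′ = w [ p ]≔ nothing
    w″ = relocate w p q r
    w′[q] : lookup w′ q ≡ nothing
    w′[q] = trans (lookup∘update′ q≢p w nothing) w[q]

  -- A move within a row keeps all row counts. In the other case the bounds force `ν + 1` rooks in
  -- row `r₀` and `ν` in row `r`, and the move interchanges these two numbers.
  relocate-balanced : ∀ {ν s} → Balanced m n ν s w →
    r₀ ≡ r ⊎ (ν < occ (just r₀) w × occ (just r) w ≤ ν) → Balanced m n ν s (relocate w p q r)
  relocate-balanced {ν} {s} (blanks , bounds) allowed =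
    -- Neither `just r₀` nor `just r` is a blank, so both indicators compute to `0`.
    trans (cong (_+ (n * ν + s)) (+-cancelʳ-≡ 0 _ _ (occ-relocate nothing))) blanks ,
    λ x → rows x allowed (occ-relocate (just x))
    where
    rows : ∀ x → r₀ ≡ r ⊎ (ν < occ (just r₀) w × occ (just r) w ≤ ν) →
      occ (just x) (relocate w p q r) + 𝟙 (just r₀ == just x) ≡ occ (just x) w + 𝟙 (just r == just x) →
      ν ≤ occ (just x) (relocate w p q r) × occ (just x) (relocate w p q r) ≤ suc ν
    rows x (inj₁ refl) eq = subst (λ t → ν ≤ t × t ≤ suc ν) (sym (+-cancelʳ-≡ (𝟙 (just r == just x)) _ _ eq)) (bounds x)
    rows x (inj₂ (r₀-full , r-notFull)) eq with r₀ F.≟ x | r F.≟ x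
    ... | yes refl | yes refl = contradiction r-notFull (<⇒≱ r₀-full)
    ... | no _     | no _     = subst (λ t → ν ≤ t × t ≤ suc ν) (sym (+-cancelʳ-≡ 0 _ _ eq)) (bounds x)
    ... | yes refl | no _     =
      ≤-pred (subst (ν <_) w≡ r₀-full) , ≤-trans (n≤1+n _) (subst (_≤ suc ν) w≡ (proj₂ (bounds x)))
      where
      w≡ : occ (just x) w ≡ suc (occ (just x) (relocate w p q r))
      w≡ = trans (sym (+-identityʳ _)) (trans (sym eq) (+-comm _ 1))
    ... | no _     | yes refl = subst (λ t → ν ≤ t × t ≤ suc ν) (sym w≡)
      (≤-trans (proj₁ (bounds x)) (n≤1+n _) , s≤s r-notFull)
      where
      w≡ : occ (just x) (relocate w p q r) ≡ suc (occ (just x) w)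
      w≡ = trans (sym (+-identityʳ _)) (trans eq (+-comm _ 1))

module _ (w : Word m (suc n)) {p q : Fin m} {r₀ r : Fin (suc n)}
  (w[p] : lookup w p ≡ just r₀) (w[q] : lookup w q ≡ nothing) where

  -- The first change is at `p`, where a blank replaces an unfavoured row.
  relocate-later-≺ : p F.< q → r₀ ≢ favoured (blanksBefore 0 w p) → 0 ⊢ relocate w p q r ≺ w
  relocate-later-≺ p<q unfavoured = firstDifference⇒≺ p
    ( (λ x x<p → lookup-relocate w w[p] w[q] (Fin.<⇒≢ x<p) (Fin.<⇒≢ (Fin.<-trans x<p p<q)))
    , subst₂ (λ a b → rank (blanksBefore 0 w p) a < rank (blanksBefore 0 w p) b)
        (sym (lookup-relocate-p w w[p] w[q])) (sym w[p])
        (subst (1 <_) (sym (rank-other unfavoured)) (s<s z<s)))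

  -- The first change is at `q`, where the favoured row replaces a blank.
  relocate-earlier-≺ : q F.< p → r ≡ favoured (blanksBefore 0 w q) → 0 ⊢ relocate w p q r ≺ w
  relocate-earlier-≺ q<p is-favoured = firstDifference⇒≺ q
    ( (λ x x<q → lookup-relocate w w[p] w[q] (Fin.<⇒≢ (Fin.<-trans x<q q<p)) (Fin.<⇒≢ x<q))
    , subst₂ (λ a b → rank (blanksBefore 0 w q) a < rank (blanksBefore 0 w q) b)
        (sym (lookup-relocate-q w w[p] w[q])) (sym w[q])
        (subst (_< 1) (sym (rank-favoured is-favoured)) z<s))

-- The data that the shelling condition needs for `A` before `B`: the moved rook is the vertex
-- removed from `B`, and `foreign` keeps it out of `A`, so that the relocated word still contains
-- the intersection of `A` and `B`.
record ShellingMove {m n} (ν s : ℕ) (A B : Word m (suc n)) : Set where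
  field
    {from to} : Fin m
    {r₀ r}    : Fin (suc n)
    at-from   : lookup B from ≡ just r₀
    at-to     : lookup B to ≡ nothing
    foreign   : lookup A from ≢ just r₀
    balanced  : Balanced m (suc n) ν s (relocate B from to r)
    precedes  : 0 ⊢ relocate B from to r ≺ B

-- A shelling move for every pair of facets

module _ {m n ν s : ℕ} {A B : Word m (suc n)}
  (balA : Balanced m (suc n) ν s A) (balB : Balanced m (suc n) ν s B) where

  -- Since `A` and `B` agree before `c`, a rook of `B` outside `A` lies to the right of the blank
  -- `c`, and moving it to `c` goes down in the order.
  fill-blank-from : ∀ {c p r₀} → (∀ q → q F.< c → lookup A q ≡ lookup B q) → lookup B c ≡ nothing →
    lookup A p ≢ just r₀ → lookup B p ≡ just r₀ →
    (let r = favoured (blanksBefore 0 B c)) →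
    r₀ ≡ r ⊎ (ν < occ (just r₀) B × occ (just r) B ≤ ν) → ShellingMove ν s A B
  fill-blank-from {c} {p} agree B[c] A[p] B[p] allowed = record
    { at-from  = B[p]
    ; at-to    = B[c]
    ; foreign  = A[p]
    ; balanced = relocate-balanced B B[p] B[c] balB allowed
    ; precedes = relocate-earlier-≺ B B[p] B[c] c<p refl
    }
    where
    c<p : c F.< p
    c<p with Fin.<-cmp c p
    ... | tri< c<p _ _  = c<p
    ... | tri≈ _ refl _ = contradiction (trans (sym B[p]) B[c]) λ ()
    ... | tri> _ _ p<c  = contradiction (trans (agree p p<c) B[p]) A[p]

  fill-blank : ∀ {c} → (∀ q → q F.< c → lookup A q ≡ lookup B q) →
    lookup B c ≡ nothing → lookup A c ≡ just (favoured (blanksBefore 0 B c)) → ShellingMove ν s A B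
  fill-blank {c} agree B[c] A[c] = fill (≤-<-connex (occ (just r) A) (occ (just r) B))
    where
    r : Fin (suc n)
    r = favoured (blanksBefore 0 B c)
    fill : occ (just r) A ≤ occ (just r) B ⊎ occ (just r) B < occ (just r) A → ShellingMove ν s A B
    fill (inj₁ occA≤occB)
      -- At `c` only `A` has a rook of row `r`; as `B` has no fewer of them, it has one in a column
      -- where `A` does not.
      with count-≤⇒∃ (λ p → lookup A p == just r) (λ p → lookup B p == just r)
             occA≤occB c (≡⇒== A[c]) (≢⇒== λ eq → contradiction (trans (sym B[c]) eq) λ ())
    ... | p , A[p] , B[p] = fill-blank-from agree B[c] (==⇒≢ _ _ A[p]) (==⇒≡ _ _ B[p]) (inj₁ refl)
    fill (inj₂ occB<occA)
      -- Both words have `suc n * ν + s` rooks, so the deficit of `B` in row `r` is made up in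
      -- another row.
      with sum-≤⇒∃ (λ r → occ (just r) A) (λ r → occ (just r) B)
             (≤-reflexive (trans (sum-balanced {w = A} balA) (sym (sum-balanced {w = B} balB)))) r occB<occA
    ... | r₀ , occA<occB
      with count-<⇒∃ (λ p → lookup A p == just r₀) (λ p → lookup B p == just r₀) occA<occB
    ...   | p , A[p] , B[p] = fill-blank-from agree B[c] (==⇒≢ _ _ A[p]) (==⇒≡ _ _ B[p])
      -- Row `r₀` has more rooks in `B` than in `A`, hence more than `ν`; row `r` has fewer, hence
      -- at most `ν`.
      (inj₂ (≤-<-trans (proj₁ (proj₂ balA r₀)) occA<occB , ≤-pred (≤-trans occB<occA (proj₂ (proj₂ balA r)))))

  move-rook : n ≤ occ nothing B → ∀ {c r₀} → lookup B c ≡ just r₀ → lookup A c ≢ just r₀ →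
    r₀ ≢ favoured (blanksBefore 0 B c) → ShellingMove ν s A B
  move-rook n≤blanks {c} {r₀} B[c] A[c] unfavoured with toℕ r₀ <? blanksBefore 0 B c
  ... | yes r₀<j with earlier-blank 0 B c (toℕ r₀) z≤n r₀<j
  ...   | q , q<c , B[q] , j≡r₀ = record
    { at-from = B[c] ; at-to = B[q] ; foreign = A[c]
    ; balanced = relocate-balanced B B[c] B[q] balB (inj₁ refl)
    -- Exactly `toℕ r₀` blanks precede `q`, and `toℕ r₀ ≤ n`, so `r₀` is the favoured row there.
    ; precedes = relocate-earlier-≺ B B[c] B[q] q<c (Fin.toℕ-injective (begin
        toℕ r₀                                  ≡⟨ m≤n⇒m⊓n≡m (toℕ≤pred[n] r₀) ⟨
        toℕ r₀ ⊓ n                              ≡⟨ cong (_⊓ n) j≡r₀ ⟨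
        blanksBefore 0 B q ⊓ n                  ≡⟨ toℕ-fromℕ< _ ⟨
        toℕ (favoured {n} (blanksBefore 0 B q)) ∎))
    }
    where open ≡-Reasoning
  move-rook n≤blanks {c} {r₀} B[c] A[c] unfavoured | no r₀≮j
    with later-blank 0 B c (<-≤-trans j<r₀ (≤-trans (toℕ≤pred[n] r₀) n≤blanks))
           (λ eq → contradiction (trans (sym eq) B[c]) λ ())
    where
    j≤r₀ : blanksBefore 0 B c ≤ toℕ r₀
    j≤r₀ = ≮⇒≥ r₀≮j
    -- Equality would make `r₀` favoured, since the minimum with `n` does not change a number that
    -- is at most `toℕ r₀`.
    j<r₀ : blanksBefore 0 B c < toℕ r₀
    j<r₀ = ≤∧≢⇒< j≤r₀ λ j≡r₀ → unfavoured (Fin.toℕ-injective (trans (sym j≡r₀)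
      (sym (trans (toℕ-fromℕ< _) (m≤n⇒m⊓n≡m (≤-trans j≤r₀ (toℕ≤pred[n] r₀)))))))
  ... | q , c<q , B[q] = record
    { at-from = B[c] ; at-to = B[q] ; foreign = A[c]
    ; balanced = relocate-balanced B B[c] B[q] balB (inj₁ refl)
    ; precedes = relocate-later-≺ B B[c] B[q] c<q unfavoured
    }

  shellingMove : n ≤ occ nothing B → 0 ⊢ A ≺ B → ShellingMove ν s A B
  shellingMove n≤blanks A≺B with ≺⇒firstDifference A≺B
  ... | c , agree , lt = go (lookup B c) refl
    where
    j = blanksBefore 0 B c
    go : ∀ b → lookup B c ≡ b → ShellingMove ν s A B
    go nothing   B[c] = fill-blank agree B[c] (rank<1⇒favoured j _ (subst (λ b → rank j (lookup A c) < rank j b) B[c] lt))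
    go (just r₀) B[c] = move-rook n≤blanks B[c]
      (λ A[c] → <-irrefl (cong (rank j) (trans A[c] (sym B[c]))) lt)
      -- A favoured row has rank `0`, and the letter of `A` would have to rank below it.
      (λ fav → contradiction (subst (rank j (lookup A c) <_) (trans (cong (rank j) B[c]) (rank-favoured fav)) lt) λ ())

-- Assembling the shelling

shelling : ∀ m n ν s → s ≤ suc n → n + (suc n * ν + s) ≤ m →
  IsShellable (SymMultChessboard m (suc n) (kVec (suc n) ν s))
shelling m n ν s s≤n enough =
  List.length facets , (toSubset ∘ List.lookup facets) ,
  (λ i → balanced⇒facet s≤n {List.lookup facets i} (lookup-balanced i)) , exhaustive , shell
  where
  facets : List (Word m (suc n))
  facets = filter (balanced? m (suc n) ν s) (words m n 0)
  facets-sorted : AllPairs (0 ⊢_≺_) facets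
  facets-sorted = AllPairs.filter⁺ (balanced? m (suc n) ν s) (words-sorted m n 0)
  lookup-balanced : ∀ i → Balanced m (suc n) ν s (List.lookup facets i)
  lookup-balanced i = proj₂ (∈-filter⁻ (balanced? m (suc n) ν s) {xs = words m n 0} (∈-lookup i))
  ∈-facets : ∀ {w} → Balanced m (suc n) ν s w → w ∈ facets
  ∈-facets {w} bal = ∈-filter⁺ (balanced? m (suc n) ν s) (∈-words 0 w) bal
  exhaustive : ∀ G → IsFacet (SymMultChessboard m (suc n) (kVec (suc n) ν s)) G →
    ∃[ i ] (∀ v → G v ≡ toSubset (List.lookup facets i) v)
  exhaustive G G-facet with facet⇒balanced s≤n (m+n≤o⇒n≤o n enough) G G-facet
  ... | w , bal , G≗w = index (∈-facets {w} bal) , λ v →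
    trans (G≗w v) (cong (λ u → toSubset u v) (lookup-index (∈-facets {w} bal)))
  -- The bound on `m` provides for all rooks and `n` further columns, and each column without a rook
  -- is blank.
  n≤blanks : ∀ {w} → Balanced m (suc n) ν s w → n ≤ occ nothing w
  n≤blanks (blanks , _) = +-cancelʳ-≤ _ _ _ (≤-trans enough (≤-reflexive (sym blanks)))
  shell : ∀ i j → toℕ i < toℕ j →
    let F = toSubset ∘ List.lookup facets in
    ∃[ k ] (toℕ k < toℕ j × Σ (Board m (suc n)) λ v → F j v ≡ true ×
      ((F i ∩ F j) ⊆ F k) × (∀ w → ((F k ∩ F j) w ≡ true) ⇔ (F j w ≡ true × w ≢ v)))
  -- The removed vertex is the rook that moves: `C` is blank in column `from`, its new rook stands
  -- in a column that is blank in `B`, and all other rooks of `B` stay.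
  shell i j i<j = h , h<j , (from , r₀) , ≡⇒== at-from , A∩B⊆C , λ v → mk⇔ (C∩B⇒ v) (⇒C∩B v)
    where
    A B C : Word m (suc n)
    A = List.lookup facets i
    B = List.lookup facets j
    open ShellingMove (shellingMove (lookup-balanced i) (lookup-balanced j) (n≤blanks {B} (lookup-balanced j))
      (lookup-sorted facets-sorted i<j))
    C = relocate B from to r
    h : Fin (List.length facets)
    h = index (∈-facets {C} balanced)
    C≡ : C ≡ List.lookup facets h
    C≡ = lookup-index (∈-facets {C} balanced)
    h<j : h F.< j
    h<j = index-< ≺-asym facets-sorted h j (subst (0 ⊢_≺ B) C≡ precedes)
    kept : ∀ {x y} → x ≢ from → lookup B x ≡ just y → toSubset (List.lookup facets h) (x , y) ≡ true
    kept {x} {y} x≢from B[x] = subst (λ w → toSubset w (x , y) ≡ true) C≡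
      (≡⇒== (trans (lookup-relocate B at-from at-to x≢from x≢to) B[x]))
      where
      x≢to : x ≢ to
      x≢to refl = contradiction (trans (sym B[x]) at-to) λ ()
    A∩B⊆C : (toSubset A ∩ toSubset B) ⊆ toSubset (List.lookup facets h)
    A∩B⊆C (x , y) A∩B = kept x≢from B[x]
      where
      B[x] : lookup B x ≡ just y
      B[x] = toSubset-true B (∧-conicalʳ (toSubset A (x , y)) _ A∩B)
      x≢from : x ≢ from
      x≢from refl = foreign (trans (toSubset-true A (∧-conicalˡ _ _ A∩B)) (trans (sym B[x]) at-from))
    C∩B⇒ : ∀ v → (toSubset (List.lookup facets h) ∩ toSubset B) v ≡ true → toSubset B v ≡ true × v ≢ (from , r₀)
    C∩B⇒ (x , y) C∩B = ∧-conicalʳ (toSubset (List.lookup facets h) (x , y)) _ C∩B , λ { refl →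
      contradiction
        (trans (sym (toSubset-true C (subst (λ w → toSubset w (x , y) ≡ true) (sym C≡) (∧-conicalˡ _ _ C∩B))))
               (lookup-relocate-p B at-from at-to)) λ () }
    ⇒C∩B : ∀ v → toSubset B v ≡ true × v ≢ (from , r₀) → (toSubset (List.lookup facets h) ∩ toSubset B) v ≡ true
    ⇒C∩B (x , y) (v∈B , v≢) = cong₂ _∧_ (kept x≢from B[x]) v∈B
      where
      B[x] : lookup B x ≡ just y
      B[x] = toSubset-true B v∈B
      x≢from : x ≢ from
      x≢from refl = v≢ (cong (x ,_) (just-injective (trans (sym B[x]) at-from)))

theorem4p2 : (m n ν s : ℕ) → 1 ≤ m → 1 ≤ n → s ≤ n →
    n * suc ν + s ∸ 1 ≤ m →
    IsShellable (SymMultChessboard m n (kVec n ν s))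
theorem4p2 m (suc n) ν s _ _ s≤n enough = shelling m n ν s s≤n (subst (_≤ m) N+n≡ enough)
  where
  N+n≡ : suc n * suc ν + s ∸ 1 ≡ n + (suc n * ν + s)
  -- After `*-suc`, the truncated subtraction takes one unit from `suc n` and leaves `n`, the number
  -- of guaranteed blanks.
  N+n≡ = trans (cong (λ t → t + s ∸ 1) (*-suc (suc n) ν)) (+-assoc n (suc n * ν) s)
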